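{- Let $U,V$ be nonempty sets, $A$ a fuzzy subset of $U$ and $B$ a fuzzy subset of $V$. Let $\odot$ be a semi-overlap function having $1$ as neutral element and $\rightarrow$ its residual implication. Suppose $A$ is normal, i.e. there is $u_0\in U$ with $A(u_0)=1$. If $A^*=A$, then the fuzzy subset $B^*$ of $V$ defined by $$B^*(v)=\sup_{u\in U}\big\{A^*(u)\odot[(A^*(u)\rightarrow A(u))\odot(A(u)\rightarrow B(v))]\big\}$$ satisfies $B^*=B$.
   Context: A semi-overlap function is a function $\odot:[0,1]^2\to[0,1]$ such that for all $u,v\in[0,1]$: $u\odot v=v\odot u$; if $uv=0$ then $u\odot v=0$; if $uv=1$ then $u\odot v=1$; $\odot$ is increasing in each variable; and $\odot$ is left-continuous: $u\odot\sup_{i\in I}v_i=\sup_{i\in I}(u\odot v_i)$ for every $u$ and nonempty family $\{v_i\}_{i\in I}\subseteq[0,1]$. $1$ is a neutral element if $1\odot v=v$ for all $v$. The residual implication is $a\rightarrow b=\sup\{w\in[0,1]\mid a\odot w\le b\}$. A fuzzy subset of $U$ is a function $U\to[0,1]$. (The displayed $B^*$ is the FMP-solution of the quintuple implication principle for rule $A\rightarrow B$ and input $A^*$; the paper phrases the theorem as "the FMP problem satisfies the reversibility of QIP method".) -}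

module Defs where

open import Level using (Level; suc)
open import Algebra.Bundles using (CommutativeRing)
open import Data.Product.Base using (Σ; ∃; _×_; _,_; proj₁; proj₂)
open import Data.Sum.Base using (inj₁; inj₂)
open import Function.Base using (_on_)
open import Relation.Binary.Core using (Rel)
open import Relation.Binary.Definitions
  using (LeftMonotonic; RightMonotonic)
open import Relation.Binary.Structures using (IsTotalOrder)
open import Relation.Nullary.Negation.Core using (¬_)
open import Relation.Unary using (Pred; Satisfiable)
import Algebra.Definitions as AlgebraDefinitions
import Algebra.Properties.Ring as RingProperties

-- The real numbers, by their classical axiomatization: a (Dedekind-)complete
-- ordered field, which is unique up to isomorphism.  "Set" means a type in
-- `Set ℓ`, equality of reals is the setoid equality of the ring, and
-- completeness is the classical least-upper-bound axiom.
record Reals (ℓ : Level) : Set (suc ℓ) where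
  infix 4 _≤_
  field
    commutativeRing : CommutativeRing ℓ ℓ

  open CommutativeRing commutativeRing public

  field
    0≉1          : ¬ (0# ≈ 1#)
    inverse      : ∀ x → ¬ (x ≈ 0#) → ∃ λ y → x * y ≈ 1#
    _≤_          : Rel Carrier ℓ
    isTotalOrder : IsTotalOrder _≈_ _≤_
    +-monoˡ-≤    : ∀ {x y} z → x ≤ y → x + z ≤ y + z
    *-nonneg     : ∀ {x y} → 0# ≤ x → 0# ≤ y → 0# ≤ x * y

  UpperBound : Pred Carrier ℓ → Pred Carrier ℓ
  UpperBound P s = ∀ {x} → P x → x ≤ s

  IsSup : Pred Carrier ℓ → Pred Carrier ℓ
  IsSup P s = UpperBound P s × (∀ {t} → UpperBound P t → s ≤ t)

  field
    complete : (P : Pred Carrier ℓ) → Satisfiable P →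
               Satisfiable (UpperBound P) → ∃ (IsSup P)

module RealOrder {ℓ : Level} (ℝ : Reals ℓ) where

  open Reals ℝ public
  open IsTotalOrder isTotalOrder public
    using (antisym; total; ≤-respʳ-≈; ≤-respˡ-≈)
    renaming (refl to ≤-refl; reflexive to ≤-reflexive; trans to ≤-trans)
  open RingProperties ring using (-1*x≈-x; -‿involutive)

  0≤1 : 0# ≤ 1#
  0≤1 with total 0# 1#
  ... | inj₁ 0≤1# = 0≤1#
  ... | inj₂ 1≤0 =
    ≤-respʳ-≈ (trans (-1*x≈-x (- 1#)) (-‿involutive 1#)) (*-nonneg 0≤-1 0≤-1)
    where
    0≤-1 : 0# ≤ - 1#
    0≤-1 = ≤-respˡ-≈ (-‿inverseʳ 1#)
             (≤-respʳ-≈ (+-identityˡ (- 1#)) (+-monoˡ-≤ (- 1#) 1≤0))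

module Fuzzy {ℓ : Level} (ℝ : Reals ℓ) where

  private module R = RealOrder ℝ

  infix 4 _≈_ _≤_ _≐_

  record 𝕀 : Set ℓ where
    constructor mk𝕀
    field
      value   : R.Carrier
      0≤value : R.0# R.≤ value
      value≤1 : value R.≤ R.1#

  open 𝕀 public

  _≈_ : Rel 𝕀 ℓ
  _≈_ = R._≈_ on value

  _≤_ : Rel 𝕀 ℓ
  _≤_ = R._≤_ on value

  0𝕀 : 𝕀
  0𝕀 = mk𝕀 R.0# R.≤-refl R.0≤1

  1𝕀 : 𝕀
  1𝕀 = mk𝕀 R.1# R.0≤1 R.≤-refl

  open AlgebraDefinitions _≈_ public using (Commutative; LeftIdentity)

  Image : {I : Set ℓ} → (I → 𝕀) → Pred R.Carrier ℓ
  Image {I} f x = Σ I λ i → x R.≈ value (f i)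

  private
    realSup : {I : Set ℓ} → I → (f : I → 𝕀) → ∃ (R.IsSup (Image f))
    realSup i₀ f = R.complete (Image f)
      (value (f i₀) , i₀ , R.refl)
      (R.1# , λ (i , x≈fi) → R.≤-respˡ-≈ (R.sym x≈fi) (value≤1 (f i)))

  -- The supremum in ℝ of a family in [0,1].  The element of the index type only
  -- witnesses that the family is nonempty: least upper bounds are unique up to _≈_.
  ⋁ : {I : Set ℓ} → I → (I → 𝕀) → 𝕀
  ⋁ i₀ f = mk𝕀 (proj₁ s)
    (R.≤-trans (0≤value (f i₀)) (proj₁ (proj₂ s) (i₀ , R.refl)))
    (proj₂ (proj₂ s) λ (i , x≈fi) → R.≤-respˡ-≈ (R.sym x≈fi) (value≤1 (f i)))
    where s = realSup i₀ f

  -- Compatibility of _⊙_ with _≈_ follows from monotonicity and antisymmetry.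
  record SemiOverlap : Set (suc ℓ) where
    infixl 7 _⊙_
    field
      _⊙_            : 𝕀 → 𝕀 → 𝕀
      comm           : Commutative _⊙_
      zero-boundary  : ∀ u v → value u R.* value v R.≈ R.0# → u ⊙ v ≈ 0𝕀
      one-boundary   : ∀ u v → value u R.* value v R.≈ R.1# → u ⊙ v ≈ 1𝕀
      monoʳ          : LeftMonotonic _≤_ _≤_ _⊙_
      monoˡ          : RightMonotonic _≤_ _≤_ _⊙_
      leftContinuous : ∀ u {I : Set ℓ} (i₀ : I) (v : I → 𝕀) →
                       u ⊙ ⋁ i₀ v ≈ ⋁ i₀ (λ i → u ⊙ v i)

    HasNeutralOne : Set ℓ
    HasNeutralOne = LeftIdentity 1𝕀 _⊙_

    -- The set {w ∣ a ⊙ w ≤ b} always contains 0.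
    residual-inhabited : ∀ a b → Σ 𝕀 λ w → a ⊙ w ≤ b
    residual-inhabited a b = 0𝕀 ,
      R.≤-respˡ-≈ (R.sym (zero-boundary a 0𝕀 (R.zeroʳ (value a)))) (0≤value b)

    infixr 6 _⇒_
    _⇒_ : 𝕀 → 𝕀 → 𝕀
    a ⇒ b = ⋁ (residual-inhabited a b) proj₁

  FuzzySubset : Set ℓ → Set ℓ
  FuzzySubset U = U → 𝕀

  _≐_ : {U : Set ℓ} → Rel (FuzzySubset U) ℓ
  A ≐ B = ∀ u → A u ≈ B u

  Normal : {U : Set ℓ} → FuzzySubset U → Set ℓ
  Normal A = ∃ λ u₀ → A u₀ ≈ 1𝕀

  -- The solution B* of the quintuple implication principle for fuzzy modus ponens
  -- with rule A → B and input A*; the element of U witnesses that U is nonempty.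
  QIP-FMP : SemiOverlap → {U V : Set ℓ} → U →
            FuzzySubset U → FuzzySubset V → FuzzySubset U → FuzzySubset V
  QIP-FMP O u₁ A B A* v = ⋁ u₁ λ u → A* u ⊙ ((A* u ⇒ A u) ⊙ (A u ⇒ B v))
    where open SemiOverlap O

module Submission where

open import Defs
open import Level using (Level)
open import Data.Product.Base using (_,_; proj₁; proj₂)

-- Modus ponens a ⊙ (a ⇒ b) ≤ b, a consequence of left-continuity, bounds every
-- member of the family defining B* by B.  At a point u₀ where A u₀ ≈ 1, both
-- A* u₀ and A* u₀ ⇒ A u₀ are at least 1 and A u₀ ⇒ B v is at least B v, so the
-- bound is attained there.  Associativity of ⊙ is not available.

module FuzzyProperties {ℓ : Level} (ℝ : Reals ℓ) where

  open Fuzzy ℝ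
  private module R = RealOrder ℝ

  -- The underscores are forced by unfolding ⋁ to R.complete.
  ⋁-isSup : {I : Set ℓ} (i₀ : I) (f : I → 𝕀) → R.IsSup (Image f) (value (⋁ i₀ f))
  ⋁-isSup i₀ f = proj₂ (R.complete (Image f) _ _)

  ⋁-upper : {I : Set ℓ} (i₀ : I) (f : I → 𝕀) → ∀ i → f i ≤ ⋁ i₀ f
  ⋁-upper i₀ f i = proj₁ (⋁-isSup i₀ f) (i , R.refl)

  ⋁-least : {I : Set ℓ} (i₀ : I) (f : I → 𝕀) (b : 𝕀) →
            (∀ i → f i ≤ b) → ⋁ i₀ f ≤ b
  ⋁-least i₀ f b f≤b =
    proj₂ (⋁-isSup i₀ f) λ (i , x≈fi) → R.≤-respˡ-≈ (R.sym x≈fi) (f≤b i)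

  module SemiOverlapProperties (O : SemiOverlap) where

    open SemiOverlap O

    ⊙-mono-≤ : ∀ {a b c d} → a ≤ b → c ≤ d → a ⊙ c ≤ b ⊙ d
    ⊙-mono-≤ {b = b} {c = c} a≤b c≤d = R.≤-trans (monoˡ c a≤b) (monoʳ b c≤d)

    ⇒-greatest : ∀ a b w → a ⊙ w ≤ b → w ≤ a ⇒ b
    ⇒-greatest a b w aw≤b = ⋁-upper (residual-inhabited a b) proj₁ (w , aw≤b)

    -- Left-continuity moves `a ⊙_` inside the supremum; each index `(w , p)` then carries its own
    -- bound `p : a ⊙ w ≤ b`.
    modus-ponens : ∀ a b → a ⊙ (a ⇒ b) ≤ b
    modus-ponens a b =
      R.≤-respˡ-≈ (R.sym (leftContinuous a i₀ proj₁))
        (⋁-least i₀ (λ i → a ⊙ proj₁ i) b proj₂)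
      where i₀ = residual-inhabited a b

    module _ (neutral : HasNeutralOne) where

      ⊙-≤ʳ : ∀ a b → a ⊙ b ≤ b
      ⊙-≤ʳ a b = R.≤-respʳ-≈ (neutral b) (monoˡ b (value≤1 a))

      ⊙-≤ˡ : ∀ a b → a ⊙ b ≤ a
      ⊙-≤ˡ a b = R.≤-respˡ-≈ (comm b a) (⊙-≤ʳ b a)

      1≤⇒ : ∀ a b → a ≤ b → 1𝕀 ≤ a ⇒ b
      1≤⇒ a b a≤b = ⇒-greatest a b 1𝕀 (R.≤-trans (⊙-≤ˡ a 1𝕀) a≤b)

      -- Applied twice to strip the two outer factors of `term u₀`; monotonicity compares with
      -- `1𝕀 ⊙ b`, which is `b`.
      ≤-1≤⊙ : ∀ a b c → 1𝕀 ≤ a → b ≤ c → b ≤ a ⊙ c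
      ≤-1≤⊙ a b c 1≤a b≤c = R.≤-respˡ-≈ (neutral b) (⊙-mono-≤ 1≤a b≤c)

theorem4p4 : {ℓ : Level} (ℝ : Reals ℓ) → let open Fuzzy ℝ in
    {U V : Set ℓ} (u₁ : U) (v₁ : V)
    (A : FuzzySubset U) (B : FuzzySubset V)
    (O : SemiOverlap) → SemiOverlap.HasNeutralOne O →
    Normal A →
    (A* : FuzzySubset U) → A* ≐ A →
    QIP-FMP O u₁ A B A* ≐ B
theorem4p4 ℝ {U} u₁ v₁ A B O neutral (u₀ , Au₀≈1) A* A*≐A v =
  R.antisym (⋁-least u₁ term (B v) term≤B)
            (R.≤-trans B≤term (⋁-upper u₁ term u₀))
  where
  module R = RealOrder ℝ
  open Fuzzy ℝ
  open SemiOverlap O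
  open FuzzyProperties ℝ
  open SemiOverlapProperties O

  term : U → 𝕀
  term u = A* u ⊙ ((A* u ⇒ A u) ⊙ (A u ⇒ B v))

  term≤B : ∀ u → term u ≤ B v
  term≤B u = R.≤-trans
    -- Dropping the middle factor leaves exactly the shape of modus ponens, with `A u` in place of
    -- `A* u`.
    (⊙-mono-≤ (R.≤-reflexive (A*≐A u)) (⊙-≤ʳ neutral (A* u ⇒ A u) (A u ⇒ B v)))
    (modus-ponens (A u) (B v))

  B≤term : B v ≤ term u₀
  B≤term =
    ≤-1≤⊙ neutral (A* u₀) (B v) ((A* u₀ ⇒ A u₀) ⊙ (A u₀ ⇒ B v))
      (R.≤-reflexive (R.sym (R.trans (A*≐A u₀) Au₀≈1)))
      (≤-1≤⊙ neutral (A* u₀ ⇒ A u₀) (B v) (A u₀ ⇒ B v)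
        (1≤⇒ neutral (A* u₀) (A u₀) (R.≤-reflexive (A*≐A u₀)))
        -- `B v` itself is a candidate `w` in the supremum defining `A u₀ ⇒ B v`.
        (⇒-greatest (A u₀) (B v) (B v) (⊙-≤ʳ neutral (A u₀) (B v))))
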